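{- Let $D$ be a vf-safe delta-matroid with ground set $[n]$, let $(U,\Omega)$ be an $(n,3)$-carrier, let $\tau=(T_1,T_2,T_3)$ be a transversal $3$-tuple of $(U,\Omega)$, and let $\sigma:U\to[n]$ be a projection of $(U,\Omega)$. Then $$\operatorname{Orb}(D)=\{D_{Z_{D,\tau,\sigma},\tau',\sigma'}\mid \tau'\in\mathbb{T}_{(U,\Omega)},\ \sigma'\in\mathbb{P}_{(U,\Omega)}\}.$$
   Context: Set systems and the group action. A set system on $[n]=\{1,\dots,n\}$ is a pair $D=([n],\mathcal{F})$, $\mathcal{F}=\mathcal{F}(D)$ a collection of subsets of $[n]$ (feasible sets). It is a delta-matroid if $\mathcal{F}\ne\emptyset$ and for all $X,Y\in\mathcal{F}$ and $u\in X\triangle Y$ there is $v\in X\triangle Y$ (possibly $v=u$) with $X\triangle\{u,v\}\in\mathcal{F}$. For $i\in[n]$: $D\ast i=([n],\{X\triangle\{i\}:X\in\mathcal{F}\})$ and $D+i=([n],\mathcal{F}\triangle\{I\cup\{i\}:I\in\mathcal{F},i\notin I\})$. For fixed $i$ these satisfy the relations of $\mathcal{G}=\langle\ast,+\mid\ast^2,+^2,(\ast+)^3\rangle\cong S_3$; write $\overline{\ast}=+\ast+=\ast+\ast$. For a word $g=g_1\cdots g_k$, $D\,g\,i:=(\cdots(D\,g_k\,i)\cdots)g_1\,i$. Operations on distinct elements commute. For $\hat g=(g_1,\dots,g_n)\in\mathcal{G}^n$, $\hat g\cdot D$ is obtained by applying $g_i$ to $i$ for all $i$. For $I\subseteq[n]$,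 $D\overline{\ast}I$ applies $\overline{\ast}$ to every element of $I$; equivalently, $X\in\mathcal{F}(D\overline{\ast}I)$ iff $|\{Y\in\mathcal{F}(D): X\subseteq Y\subseteq X\cup I\}|$ is odd. $D$ is vf-safe if $\hat g\cdot D$ is a delta-matroid for all $\hat g\in\mathcal{G}^n$. For $\pi\in S_n$, $D_\pi=([n],\{\pi(I):I\in\mathcal{F}\})$. The semidirect product $\mathcal{G}^n\rtimes_\phi S_n$, with $(\hat g,\pi_1)(\hat h,\pi_2)=(\hat g\circ\hat h\pi_1^{ -1},\pi_1\pi_2)$, $\circ$ componentwise, $(\hat h\pi^{ -1})(i)=h_{\pi^{ -1}(i)}$, acts on set systems by $(\hat g,\pi)D=\hat g\cdot D_\pi$; $\operatorname{Orb}(D)$ is the orbit of $D$. Carriers and lifts. An $(n,3)$-carrier is a pair $(U,\Omega)$ with $\Omega$ a partition of a finite set $U$ into $n$ classes (skew classes), each of size $3$. A transversal of $\Omega$ is a subset of $U$ meeting each class in exactly one element; $\mathcal{T}(\Omega)$ is the set of transversals. A transversal $3$-tuple is an ordered triple $(T_1,T_2,T_3)$ of mutually disjoint transversals with union $U$; $\mathbb{T}_{(U,\Omega)}$ is the set of them. A projection is a surjection $\sigma:U\to[n]$ with $\sigma(x)=\sigma(y)$ iff $x,y$ lie in the same skew class; $\mathbb{P}_{(U,\Omega)}$ is the set of them. For a vf-safe delta-matroid $D$ on $[n]$, $\tau=(T_1,T_2,T_3)$ and $\sigma$, let $$\mathcal{B}_{D,\tau,\sigma}=\{B\in\mathcal{T}(\Omega)\mid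 \sigma(B\cap T_2)\in\mathcal{F}(D\,\overline{\ast}\,\sigma(B\cap T_3))\}$$ and $Z_{D,\tau,\sigma}=(U,\Omega,\mathcal{B}_{D,\tau,\sigma}^*)$, where $\mathcal{B}^*=\{I\mid I\subseteq B\text{ for some }B\in\mathcal{B}\}$. This is a tight $3$-matroid with set of bases $\mathcal{B}_{D,\tau,\sigma}$. From $3$-matroids to delta-matroids. For a tight $3$-matroid $Z$ with carrier $(U,\Omega)$ and set of bases $\mathcal{B}_Z\subseteq\mathcal{T}(\Omega)$, $\tau=(T_1,T_2,T_3)\in\mathbb{T}_{(U,\Omega)}$ and $\sigma\in\mathbb{P}_{(U,\Omega)}$, $$D_{Z,\tau,\sigma}=([n],\{\sigma(X\cap T_2)\mid X\in\mathcal{B}_Z,\ X\subseteq T_1\cup T_2\}).$$ -}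

module Defs where

open import Data.Bool using (Bool; T; _xor_; if_then_else_)
open import Data.Fin using (Fin)
open import Data.Fin.Permutation using (Permutation′; _⟨$⟩ʳ_)
open import Data.Fin.Properties using (all?; any?) renaming (_≟_ to _≟ᶠ_)
open import Data.Fin.Subset
  using (Subset; _∈_; _⊆_; _⊂_; _∩_; _∪_; ⊤; ⁅_⁆; ∣_∣; Empty)
open import Data.Fin.Subset.Properties using (_∈?_; _⊆?_; _⊂?_; anySubset?)
open import Data.List using (List; []; _∷_; foldr; allFin)
open import Data.Nat using (ℕ; _≟_)
open import Data.Product using (∃; ∃!; ∃-syntax; _×_; _,_)
open import Data.Vec using (zipWith; tabulate)
import Data.Bool.Properties as Bool
open import Data.Vec.Properties using (≡-dec)
open import Function.Bundles using (_⇔_)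
open import Function.Definitions using (Surjective)
open import Level using (0ℓ)
open import Relation.Binary.Definitions using (DecidableEquality)
open import Relation.Binary.PropositionalEquality using (_≡_; _≗_)
open import Relation.Nullary using (¬_; Dec; does; ¬?; _×-dec_)
open import Relation.Nullary.Decidable using (T?)
open import Relation.Unary using (Pred; Decidable)

private
  variable
    m n : ℕ

infixl 6 _△_ _△ᶠ_ _∗_ _+_ _∗̄_
infix  4 _∈ᶠ_ _∈ᶠ?_ _≟ˢ_
infixr 7 _·_ _▷_

_△_ : Subset n → Subset n → Subset n
_△_ = zipWith _xor_

_≟ˢ_ : DecidableEquality (Subset n)
_≟ˢ_ = ≡-dec Bool._≟_

_[_] : (Fin m → Fin n) → Subset m → Subset n
f [ X ] = tabulate λ j → does (any? λ i → i ∈? X ×-dec f i ≟ᶠ j)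

-- Collections of subsets of a finite set, given by their characteristic
-- functions and compared by _≗_.

Family : ℕ → Set
Family n = Subset n → Bool

_∈ᶠ_ : Subset n → Family n → Set
X ∈ᶠ 𝓕 = T (𝓕 X)

_∈ᶠ?_ : (X : Subset n) (𝓕 : Family n) → Dec (X ∈ᶠ 𝓕)
X ∈ᶠ? 𝓕 = T? (𝓕 X)

-- { X ∣ P X }
comprehension : {P : Pred (Subset n) 0ℓ} → Decidable P → Family n
comprehension P? X = does (P? X)

-- { f X ∣ P X }
replacement : (Subset m → Subset n) →
              {P : Pred (Subset m) 0ℓ} → Decidable P → Family n
replacement f P? = comprehension λ Y → anySubset? λ X → P? X ×-dec Y ≟ˢ f X

_△ᶠ_ : Family n → Family n → Family n
(𝓕 △ᶠ 𝓖) X = 𝓕 X xor 𝓖 X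

-- A set system on [n] = Fin n is identified with its collection of feasible
-- sets.

SetSystem : ℕ → Set
SetSystem = Family

record IsDeltaMatroid (D : SetSystem n) : Set where
  field
    nonempty : ∃[ X ] X ∈ᶠ D
    exchange : ∀ {X Y} → X ∈ᶠ D → Y ∈ᶠ D → ∀ {u} → u ∈ X △ Y →
               ∃[ v ] v ∈ X △ Y × X △ (⁅ u ⁆ ∪ ⁅ v ⁆) ∈ᶠ D

_∗_ : SetSystem n → Fin n → SetSystem n
D ∗ i = replacement (_△ ⁅ i ⁆) (_∈ᶠ? D)

_+_ : SetSystem n → Fin n → SetSystem n
D + i = D △ᶠ replacement (_∪ ⁅ i ⁆) λ I → I ∈ᶠ? D ×-dec ¬? (i ∈? I)

data Generator : Set where
  star plus : Generator

-- Elements of the group ⟨ ∗ , + ∣ ∗² , +² , (∗+)³ ⟩ are represented by words.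
-- Words representing the same group element act identically on set systems,
-- so quantifying over words amounts to quantifying over the group.

𝒢 : Set
𝒢 = List Generator

apply₁ : Generator → SetSystem n → Fin n → SetSystem n
apply₁ star = _∗_
apply₁ plus = _+_

-- D g₁⋯gₖ i = (⋯ (D gₖ i) ⋯) g₁ i : the last letter acts first.
apply : SetSystem n → 𝒢 → Fin n → SetSystem n
apply D g i = foldr (λ x E → apply₁ x E i) D g

-- Operations on distinct elements commute, so the order in which the
-- elements of [n] are treated is immaterial.
_·_ : (Fin n → 𝒢) → SetSystem n → SetSystem n
_·_ {n} ĝ D = foldr (λ i E → apply E (ĝ i) i) D (allFin n)

star̄ : 𝒢
star̄ = plus ∷ star ∷ plus ∷ []

_∗̄_ : SetSystem n → Subset n → SetSystem n
D ∗̄ I = (λ i → if does (i ∈? I) then star̄ else []) · D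

VfSafe : SetSystem n → Set
VfSafe {n} D = (ĝ : Fin n → 𝒢) → IsDeltaMatroid (ĝ · D)

permute : Permutation′ n → SetSystem n → SetSystem n
permute π D = replacement ((π ⟨$⟩ʳ_) [_]) (_∈ᶠ? D)

-- The action of 𝒢ⁿ ⋊ Sₙ; an orbit depends only on the underlying set of the
-- semidirect product and on its action.
_▷_ : (Fin n → 𝒢) × Permutation′ n → SetSystem n → SetSystem n
(ĝ , π) ▷ D = ĝ · permute π D

Orb : SetSystem n → Pred (SetSystem n) 0ℓ
Orb D E = ∃[ a ] E ≗ a ▷ D

-- (n , 3)-carriers. The finite set U is Fin size. The skew classes are
-- numbered, but nothing below depends on the numbering.

record Carrier (n : ℕ) : Set where
  field
    size        : ℕ
    class       : Fin n → Subset size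
    partition   : ∀ x → ∃! _≡_ λ i → x ∈ class i
    class-size  : ∀ i → ∣ class i ∣ ≡ 3

  SameClass : Fin size → Fin size → Set
  SameClass x y = ∃[ i ] x ∈ class i × y ∈ class i

  IsTransversal : Pred (Subset size) 0ℓ
  IsTransversal B = ∀ i → ∣ B ∩ class i ∣ ≡ 1

  isTransversal? : Decidable IsTransversal
  isTransversal? B = all? λ i → ∣ B ∩ class i ∣ ≟ 1

record TransversalTuple (C : Carrier n) : Set where
  open Carrier C
  field
    T₁ T₂ T₃ : Subset size
    T₁-transversal : IsTransversal T₁
    T₂-transversal : IsTransversal T₂
    T₃-transversal : IsTransversal T₃
    T₁-T₂-disjoint : Empty (T₁ ∩ T₂)
    T₁-T₃-disjoint : Empty (T₁ ∩ T₃)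
    T₂-T₃-disjoint : Empty (T₂ ∩ T₃)
    union          : T₁ ∪ T₂ ∪ T₃ ≡ ⊤

record Projection (C : Carrier n) : Set where
  open Carrier C
  field
    σ          : Fin size → Fin n
    surjective : Surjective _≡_ _≡_ σ
    fibres     : ∀ x y → σ x ≡ σ y ⇔ SameClass x y

-- A triple (U , Ω , 𝓘) with 𝓘 a collection of subsets of U. Tight 3-matroids
-- are particular such triples; bases, and the set system read off from them,
-- make sense for all of them.

record IndependenceSystem (C : Carrier n) : Set where
  open Carrier C
  field
    independent : Family size

  -- The bases are the maximal independent sets.
  IsBasis : Pred (Subset size) 0ℓ
  IsBasis B = B ∈ᶠ independent × ¬ (∃[ I ] I ∈ᶠ independent × B ⊂ I)

  isBasis? : Decidable IsBasis
  isBasis? B = B ∈ᶠ? independent ×-dec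
               ¬? (anySubset? λ I → I ∈ᶠ? independent ×-dec B ⊂? I)

module _ {C : Carrier n} where
  open Carrier C

  -- 𝓑 D,τ,σ
  𝓑 : SetSystem n → TransversalTuple C → Projection C → Family size
  𝓑 D τ p = comprehension λ B →
      isTransversal? B ×-dec σ [ B ∩ T₂ ] ∈ᶠ? (D ∗̄ (σ [ B ∩ T₃ ]))
    where
    open TransversalTuple τ
    open Projection p

  -- Z D,τ,σ, whose independent sets are the subsets of members of 𝓑 D,τ,σ
  liftZ : SetSystem n → TransversalTuple C → Projection C →
          IndependenceSystem C
  liftZ D τ p = record
    { independent = comprehension λ I →
        anySubset? λ B → B ∈ᶠ? 𝓑 D τ p ×-dec I ⊆? B }

  -- D Z,τ,σ
  project : IndependenceSystem C → TransversalTuple C → Projection C →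
            SetSystem n
  project Z τ p =
      replacement (λ X → σ [ X ∩ T₂ ]) λ X → isBasis? X ×-dec X ⊆? (T₁ ∪ T₂)
    where
    open IndependenceSystem Z
    open TransversalTuple τ
    open Projection p

{-# OPTIONS --safe #-}

-- A set system on [n] is a vector D of (𝔽₂²)^⊗n, and the value at D of a
-- tensor product of n nonzero functionals on 𝔽₂², i.e. of a word in three
-- letters, extends the characteristic function of D, which is the restriction
-- to words in the two coordinate functionals. As the three functionals sum to
-- zero, this extension is unique, and ∗ and + act on it by transposing letters.
-- A pair (τ , σ) identifies U with [n] × {three letters}, hence transversals
-- with words, and the bases of Z are the words of value 1. So passing from
-- (τ , σ) to (τ′ , σ′) permutes the positions and, position by position, the
-- letters, and this is the action of 𝒢ⁿ ⋊ Sₙ.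

module Submission where

open import Defs
open import Algebra using (module CommutativeRing)
open import Data.Bool using (Bool; true; false; T; if_then_else_; _xor_)
open import Data.Bool.Properties
  using (xor-assoc; xor-comm; xor-same; xor-identityʳ; xor-∧-commutativeRing; T-≡)
open import Algebra.Properties.CommutativeSemigroup
  (CommutativeRing.+-commutativeSemigroup xor-∧-commutativeRing)
  using (interchange)
open import Data.Fin using (Fin; zero; suc)
open import Data.Fin.Patterns using (0F; 1F; 2F)
open import Data.Fin.Permutation
  using (Permutation′; permutation; _⟨$⟩ʳ_; _⟨$⟩ˡ_; inverseˡ; inverseʳ)
open import Data.Fin.Properties using (any?; all?) renaming (_≟_ to _≟ᶠ_)
open import Data.Fin.Subset
  using (Subset; inside; outside; _∈_; _∉_; _⊆_; _∩_; _∪_; ⊥; ⁅_⁆; ∣_∣; Nonempty; Empty)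
open import Data.Fin.Subset.Properties
  using (_∈?_; _⊆?_; anySubset?; ⊆-refl; ⊆-trans; ⊆-antisym; ⊆⊤; ∈⊤; x∈⁅x⁆; x∈⁅y⁆⇒x≡y;
         x∈⁅y⁆⇔x≡y; ∣⁅x⁆∣≡1; x∈p∩q⁺; x∈p∩q⁻; x∈p∪q⁺; x∈p∪q⁻; ∪-identityʳ)
open import Data.List using (List; []; _∷_; foldr; foldl; allFin)
import Data.List as List
import Data.List.Properties as List
import Data.List.Relation.Unary.Any as Any
open import Data.Nat using (ℕ; zero; suc)
import Data.Nat.Properties as ℕ
open import Data.Product using (∃-syntax; _×_; _,_; proj₁; proj₂)
open import Data.Sum using (_⊎_; inj₁; inj₂)
open import Data.Vec
  using (Vec; []; _∷_; here; there; map; lookup; tabulate; _[_]≔_; _[_]%=_)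
open import Data.Vec.Properties
  using ([]=⇒lookup; lookup⇒[]=; lookup∘tabulate; tabulate∘lookup; tabulate-cong; tabulate-∘;
         lookup-map; map-[]≔; []≔-lookup; []≔-idempotent; lookup∘update; lookup∘update′;
         updateAt-id; updateAt-id-local; updateAt-cong-local; updateAt-updateAt; updateAt-commutes)
open import Function using (_∘_; id)
open import Function.Bundles using (_⇔_; mk⇔; Equivalence)
open import Relation.Binary.PropositionalEquality
  using (_≡_; _≢_; _≗_; refl; sym; trans; cong; cong₂; subst; module ≡-Reasoning)
open import Relation.Nullary using (Dec; yes; no; does; ¬_; ¬?; _×-dec_; _→-dec_; contradiction)
open import Relation.Nullary.Decidable
  using (T?; does-⇔; toWitness; decidable-stable; dec-true; dec-false)
open import Relation.Unary using (Pred; Decidable; _≐_)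

open Equivalence using (to; from)
open ≡-Reasoning

private
  variable
    m n : ℕ
    A : Set

-- Booleans, decidable propositions and subsets.

T⇔T⇒≡ : ∀ {a b} → T a ⇔ T b → a ≡ b
T⇔T⇒≡ a⇔b = does-⇔ a⇔b (T? _) (T? _)

T⇔⇒≡does : ∀ {b} → T b ⇔ A → (a? : Dec A) → b ≡ does a?
T⇔⇒≡does b⇔a a? = does-⇔ b⇔a (T? _) a?

does⇔ : (a? : Dec A) → T (does a?) ⇔ A
does⇔ (yes a) = mk⇔ (λ _ → a) _
does⇔ (no ¬a) = mk⇔ (λ ()) ¬a

subset-ext : ∀ {p q : Subset n} → (∀ {x} → x ∈ p ⇔ x ∈ q) → p ≡ q
subset-ext p⇔q = ⊆-antisym (to p⇔q) (from p⇔q)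

∈-tabulate : ∀ {P : Pred (Fin n) _} (P? : Decidable P) {x} →
             x ∈ tabulate (does ∘ P?) ⇔ P x
∈-tabulate P? {x} = mk⇔
  (λ x∈ → to (does⇔ (P? x))
    (subst T (trans (sym ([]=⇒lookup x∈)) (lookup∘tabulate _ x)) _))
  (λ px → lookup⇒[]= x _ (trans (lookup∘tabulate _ x) (dec-true (P? x) px)))

∈-image : ∀ (f : Fin m → Fin n) X {j} → j ∈ f [ X ] ⇔ (∃[ i ] i ∈ X × f i ≡ j)
∈-image f X = ∈-tabulate λ j → any? λ i → i ∈? X ×-dec f i ≟ᶠ j

△-⊥ : (X : Subset n) → X △ ⊥ ≡ X
△-⊥ []      = refl
△-⊥ (x ∷ X) = cong₂ _∷_ (xor-identityʳ x) (△-⊥ X)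

△-involutive : (X Y : Subset n) → X △ Y △ Y ≡ X
△-involutive []      []      = refl
△-involutive (x ∷ X) (y ∷ Y) = cong₂ _∷_
  (trans (xor-assoc x y y) (trans (cong (x xor_) (xor-same y)) (xor-identityʳ x)))
  (△-involutive X Y)

∪-⁅⁆ : (X : Subset n) (i : Fin n) → X ∪ ⁅ i ⁆ ≡ X [ i ]≔ inside
∪-⁅⁆ (inside  ∷ X) zero    = cong (inside ∷_) (∪-identityʳ X)
∪-⁅⁆ (outside ∷ X) zero    = cong (inside ∷_) (∪-identityʳ X)
∪-⁅⁆ (inside  ∷ X) (suc i) = cong (inside ∷_) (∪-⁅⁆ X i)
∪-⁅⁆ (outside ∷ X) (suc i) = cong (outside ∷_) (∪-⁅⁆ X i)

[]≔-lookup-≡ : ∀ {xs : Vec A n} {i x} → lookup xs i ≡ x → xs [ i ]≔ x ≡ xs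
[]≔-lookup-≡ {xs = xs} {i} refl = []≔-lookup xs i

lookup-ext : (xs ys : Vec A n) → lookup xs ≗ lookup ys → xs ≡ ys
lookup-ext xs ys eq =
  trans (sym (tabulate∘lookup xs)) (trans (tabulate-cong eq) (tabulate∘lookup ys))

-- Characteristic functions of `D ∗ i`, `D + i` and `permute π D`.

∗-feasible : (D : SetSystem n) (i : Fin n) (X : Subset n) → (D ∗ i) X ≡ D (X △ ⁅ i ⁆)
∗-feasible D i X = sym (T⇔⇒≡does
  (mk⇔ (λ d → X △ ⁅ i ⁆ , d , sym (△-involutive X ⁅ i ⁆))
       λ { (I , d , refl) → subst (T ∘ D) (sym (△-involutive I ⁅ i ⁆)) d })
  (anySubset? λ I → I ∈ᶠ? D ×-dec X ≟ˢ (I △ ⁅ i ⁆)))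

module _ (D : SetSystem n) (i : Fin n) (X : Subset n) where
  private
    X∈replacement? = anySubset? λ I → (I ∈ᶠ? D ×-dec ¬? (i ∈? I)) ×-dec X ≟ˢ (I ∪ ⁅ i ⁆)

  -- The only `I` avoiding `i` with `X ≡ I ∪ ⁅ i ⁆` is `X` with `i` removed, so the second summand
  -- tests just that set.
  +-feasible-inside : lookup X i ≡ inside → (D + i) X ≡ D X xor D (X [ i ]≔ outside)
  +-feasible-inside i∈X = cong (D X xor_) (sym (T⇔⇒≡does (mk⇔
    (λ d → X [ i ]≔ outside , (d , i∉) , sym (begin
      (X [ i ]≔ outside) ∪ ⁅ i ⁆             ≡⟨ ∪-⁅⁆ _ i ⟩
      (X [ i ]≔ outside) [ i ]≔ inside       ≡⟨ []≔-idempotent X i ⟩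
      X [ i ]≔ inside                        ≡⟨ []≔-lookup-≡ i∈X ⟩
      X                                      ∎))
    λ { (I , (d , i∉I) , refl) → subst (T ∘ D) (sym (begin
      (I ∪ ⁅ i ⁆) [ i ]≔ outside             ≡⟨ cong (_[ i ]≔ outside) (∪-⁅⁆ I i) ⟩
      (I [ i ]≔ inside) [ i ]≔ outside       ≡⟨ []≔-idempotent I i ⟩
      I [ i ]≔ outside                       ≡⟨ []≔-lookup-≡ (∉⇒outside i∉I) ⟩
      I                                      ∎)) d })
    X∈replacement?))
    where
    i∉ : i ∉ X [ i ]≔ outside
    i∉ i∈ with () ← trans (sym ([]=⇒lookup i∈)) (lookup∘update i X outside)
    ∉⇒outside : ∀ {I : Subset n} → i ∉ I → lookup I i ≡ outside
    ∉⇒outside {I} i∉I with lookup I i in eq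
    ... | true  = contradiction (lookup⇒[]= i I eq) i∉I
    ... | false = refl

  +-feasible-outside : lookup X i ≡ outside → (D + i) X ≡ D X
  +-feasible-outside i∉X = trans (cong (D X xor_) (dec-false X∈replacement? absurd)) (xor-identityʳ (D X))
    where
    absurd : ¬ (∃[ I ] (T (D I) × i ∉ I) × X ≡ I ∪ ⁅ i ⁆)
    absurd (I , _ , refl)
      with () ← trans (sym ([]=⇒lookup (x∈p∪q⁺ {p = I} (inj₂ (x∈⁅x⁆ i))))) i∉X

-- Direct image under `π` is a bijection on subsets with inverse precomposition by `π`, so the
-- replacement has a single candidate for `I`.
permute-feasible : (π : Permutation′ n) (D : SetSystem n) (X : Subset n) →
                   permute π D X ≡ D (tabulate (lookup X ∘ (π ⟨$⟩ʳ_)))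
permute-feasible {n} π D X = sym (T⇔⇒≡does
  (mk⇔ (λ d → X∘π , d , sym (image X∘π (λ i → lookup∘tabulate _ i)))
       λ { (I , d , refl) → subst (T ∘ D) (sym (preimage I)) d })
  (anySubset? λ I → I ∈ᶠ? D ×-dec X ≟ˢ ((π ⟨$⟩ʳ_) [ I ])))
  where
  X∘π : Subset n
  X∘π = tabulate (lookup X ∘ (π ⟨$⟩ʳ_))

  image : ∀ I → (∀ i → lookup I i ≡ lookup X (π ⟨$⟩ʳ i)) → (π ⟨$⟩ʳ_) [ I ] ≡ X
  image I eq = subset-ext λ {j} → mk⇔
    (λ j∈ → let (i , i∈I , πi≡j) = to (∈-image _ I) j∈ in
      subst (_∈ X) πi≡j (lookup⇒[]= _ X (trans (sym (eq i)) ([]=⇒lookup i∈I))))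
    λ j∈X → from (∈-image _ I)
      ( π ⟨$⟩ˡ j
      , lookup⇒[]= _ I (trans (eq _) (trans (cong (lookup X) (inverseʳ π)) ([]=⇒lookup j∈X)))
      , inverseʳ π)

  preimage : ∀ I → tabulate (lookup ((π ⟨$⟩ʳ_) [ I ]) ∘ (π ⟨$⟩ʳ_)) ≡ I
  preimage I = subset-ext λ {i} → mk⇔
    (λ i∈ → let (k , k∈I , πk≡πi) = to (∈-image _ I)
                  (lookup⇒[]= _ _ (trans (sym (lookup∘tabulate _ i)) ([]=⇒lookup i∈))) in
      subst (_∈ I) (trans (sym (inverseˡ π)) (trans (cong (π ⟨$⟩ˡ_) πk≡πi) (inverseˡ π))) k∈I)
    λ i∈I → lookup⇒[]= i _ (trans (lookup∘tabulate _ i) ([]=⇒lookup (from (∈-image (π ⟨$⟩ʳ_) I) (i , i∈I , refl))))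

-- Values of a set system at words.

-- A word assigns to every element one of the three nonzero functionals on
-- 𝔽₂²: the two coordinates f ↦ f(∉) and f ↦ f(∈), and their sum.
Word : ℕ → Set
Word = Vec (Fin 3)

digit : Bool → Fin 3
digit false = 0F
digit true  = 1F

binary : Subset n → Word n
binary = map digit

-- Contraction of the tensor `D` with the functionals of the word. Concretely, this is the parity of
-- the number of feasible sets that contain every position lettered `1F` and avoid every position
-- lettered `0F`.
eval : SetSystem n → Word n → Bool
eval D []       = D []
eval D (0F ∷ w) = eval (D ∘ (outside ∷_)) w
eval D (1F ∷ w) = eval (D ∘ (inside ∷_)) w
eval D (2F ∷ w) = eval (D ∘ (outside ∷_)) w xor eval (D ∘ (inside ∷_)) w

-- Over 𝔽₂ this says that the three values sum to zero, a condition symmetric in the letters;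
-- isolating `2F` shows how its value is recovered from the other two.
Balanced₁ : (Fin 3 → Bool) → Set
Balanced₁ f = f 0F xor f 1F ≡ f 2F

Balanced : (Word n → Bool) → Set
Balanced W = ∀ w i → Balanced₁ λ t → W (w [ i ]≔ t)

eval-binary : (D : SetSystem n) (X : Subset n) → eval D (binary X) ≡ D X
eval-binary D []          = refl
eval-binary D (true  ∷ X) = eval-binary _ X
eval-binary D (false ∷ X) = eval-binary _ X

-- At the head this is the clause of `eval` for `2F`. Further along, a leading `0F` or `1F` only
-- restricts the set system, and a leading `2F` adds two balanced functions, whose terms
-- `interchange` regroups.
eval-balanced : (D : SetSystem n) → Balanced (eval D)
eval-balanced D (t  ∷ w) zero    = refl
eval-balanced D (0F ∷ w) (suc i) = eval-balanced _ w i
eval-balanced D (1F ∷ w) (suc i) = eval-balanced _ w i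
eval-balanced D (2F ∷ w) (suc i) = trans
  (interchange (eval (D ∘ (outside ∷_)) (w [ i ]≔ 0F)) (eval (D ∘ (inside ∷_)) (w [ i ]≔ 0F))
               (eval (D ∘ (outside ∷_)) (w [ i ]≔ 1F)) _)
  (cong₂ _xor_ (eval-balanced _ w i) (eval-balanced _ w i))

-- Balance expresses each value at `2F` through `0F` and `1F`, so induction on the word reduces to
-- binary words. Identities between values at all words thus need checking only on subsets.
balanced-unique : {V W : Word n → Bool} → Balanced V → Balanced W →
                  V ∘ binary ≗ W ∘ binary → V ≗ W
balanced-unique bV bW eq []      = eq []
balanced-unique {suc n} {V} {W} bV bW eq (t ∷ w) = go t
  where
  tail : ∀ b → V ∘ (digit b ∷_) ≗ W ∘ (digit b ∷_)
  tail b = balanced-unique (λ v i → bV (digit b ∷ v) (suc i))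
                           (λ v i → bW (digit b ∷ v) (suc i)) (eq ∘ (b ∷_))

  go : ∀ t → V (t ∷ w) ≡ W (t ∷ w)
  go 0F = tail false w
  go 1F = tail true w
  go 2F = begin
    V (2F ∷ w)                 ≡⟨ bV (0F ∷ w) zero ⟨
    V (0F ∷ w) xor V (1F ∷ w)  ≡⟨ cong₂ _xor_ (tail false w) (tail true w) ⟩
    W (0F ∷ w) xor W (1F ∷ w)  ≡⟨ bW (0F ∷ w) zero ⟩
    W (2F ∷ w)                 ∎

-- Permutations of letters and of positions preserve balance.

act₁ : Generator → Fin 3 → Fin 3
act₁ star 0F = 1F
act₁ star 1F = 0F
act₁ star 2F = 2F
act₁ plus 0F = 0F
act₁ plus 1F = 2F
act₁ plus 2F = 1F

balanced₁-act₁ : ∀ x f → Balanced₁ f → Balanced₁ (f ∘ act₁ x)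
balanced₁-act₁ star f b = trans (xor-comm (f 1F) (f 0F)) b
balanced₁-act₁ plus f b = begin
  f 0F xor f 2F             ≡⟨ cong (f 0F xor_) b ⟨
  f 0F xor (f 0F xor f 1F)  ≡⟨ xor-assoc (f 0F) _ _ ⟨
  (f 0F xor f 0F) xor f 1F  ≡⟨ cong (_xor f 1F) (xor-same (f 0F)) ⟩
  f 1F                      ∎

balanced₁-cong : ∀ {f g} → f ≗ g → Balanced₁ f → Balanced₁ g
balanced₁-cong {f} {g} eq b = trans (cong₂ _xor_ (sym (eq 0F)) (sym (eq 1F))) (trans b (eq 2F))

-- At `i` the overwriting letter is itself permuted, which balance tolerates; at any other position
-- the two updates commute.
balanced-act₁ : ∀ x (i : Fin n) W → Balanced W → Balanced λ w → W (w [ i ]%= act₁ x)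
balanced-act₁ x i W b w j with i ≟ᶠ j
... | yes refl = balanced₁-cong
        (λ t → cong W (sym (updateAt-updateAt i {f = act₁ x} {g = λ _ → t} w)))
        (balanced₁-act₁ x (λ t → W (w [ i ]≔ t)) (b w i))
... | no i≢j   = balanced₁-cong
        (λ t → cong W (updateAt-commutes j i {f = λ _ → t} {g = act₁ x} (i≢j ∘ sym) w))
        (b (w [ i ]%= act₁ x) j)

-- Overwriting `w` at `i` overwrites the pulled-back word at the preimage of `i` and nowhere else.
balanced-permute : ∀ (π : Permutation′ n) W → Balanced W →
                   Balanced λ w → W (tabulate (lookup w ∘ (π ⟨$⟩ʳ_)))
balanced-permute {n} π W b w i = balanced₁-cong
  (λ t → cong W (lookup-ext (w∘π [ π ⟨$⟩ˡ i ]≔ t) (tabulate (lookup (w [ i ]≔ t) ∘ (π ⟨$⟩ʳ_)))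
                            (pointwise t)))
  (b w∘π (π ⟨$⟩ˡ i))
  where
  w∘π : Word n
  w∘π = tabulate (lookup w ∘ (π ⟨$⟩ʳ_))

  pointwise : ∀ t j → lookup (w∘π [ π ⟨$⟩ˡ i ]≔ t) j ≡
                      lookup (tabulate (lookup (w [ i ]≔ t) ∘ (π ⟨$⟩ʳ_))) j
  pointwise t j with j ≟ᶠ π ⟨$⟩ˡ i
  ... | yes refl = begin
    lookup (w∘π [ j ]≔ t) j           ≡⟨ lookup∘update j w∘π t ⟩
    t                                 ≡⟨ lookup∘update i w t ⟨
    lookup (w [ i ]≔ t) i             ≡⟨ cong (lookup (w [ i ]≔ t)) (inverseʳ π) ⟨
    lookup (w [ i ]≔ t) (π ⟨$⟩ʳ j)    ≡⟨ lookup∘tabulate _ j ⟨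
    _                                 ∎
  ... | no j≢ = begin
    lookup (w∘π [ π ⟨$⟩ˡ i ]≔ t) j    ≡⟨ lookup∘update′ j≢ w∘π t ⟩
    lookup w∘π j                      ≡⟨ lookup∘tabulate _ j ⟩
    lookup w (π ⟨$⟩ʳ j)               ≡⟨ lookup∘update′ πj≢i w t ⟨
    lookup (w [ i ]≔ t) (π ⟨$⟩ʳ j)    ≡⟨ lookup∘tabulate _ j ⟨
    _                                 ∎
    where
    πj≢i : π ⟨$⟩ʳ j ≢ i
    πj≢i eq = j≢ (trans (sym (inverseˡ π)) (cong (π ⟨$⟩ˡ_) eq))

-- The action of 𝒢ⁿ ⋊ Sₙ on values at words.

binary-△ : ∀ (X : Subset n) i → binary (X △ ⁅ i ⁆) ≡ binary X [ i ]%= act₁ star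
binary-△ (true  ∷ X) zero    = cong (λ Y → 0F ∷ binary Y) (△-⊥ X)
binary-△ (false ∷ X) zero    = cong (λ Y → 1F ∷ binary Y) (△-⊥ X)
binary-△ (true  ∷ X) (suc i) = cong (1F ∷_) (binary-△ X i)
binary-△ (false ∷ X) (suc i) = cong (0F ∷_) (binary-△ X i)

-- If `i` is outside `X`, its letter `0F` is fixed. If inside, `1F` becomes `2F`, and balance
-- expands the value there into the two summands that define `D + i`.
eval-+-binary : ∀ (D : SetSystem n) i X →
                (D + i) X ≡ eval D (binary X [ i ]%= act₁ plus)
eval-+-binary D i X with lookup X i in eq
... | false = begin
  (D + i) X                              ≡⟨ +-feasible-outside D i X eq ⟩
  D X                                    ≡⟨ eval-binary D X ⟨
  eval D (binary X)                      ≡⟨ cong (eval D) (updateAt-id-local i (binary X) fixed) ⟨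
  eval D (binary X [ i ]%= act₁ plus)    ∎
  where
  fixed : act₁ plus (lookup (binary X) i) ≡ lookup (binary X) i
  fixed rewrite lookup-map i digit X | eq = refl
... | true = begin
  (D + i) X
    ≡⟨ +-feasible-inside D i X eq ⟩
  D X xor D (X [ i ]≔ outside)
    ≡⟨ xor-comm (D X) _ ⟩
  D (X [ i ]≔ outside) xor D X
    ≡⟨ cong (λ Y → D (X [ i ]≔ outside) xor D Y) ([]≔-lookup-≡ eq) ⟨
  D (X [ i ]≔ outside) xor D (X [ i ]≔ inside)
    ≡⟨ cong₂ _xor_ (update outside) (update inside) ⟩
  eval D (binary X [ i ]≔ 0F) xor eval D (binary X [ i ]≔ 1F)
    ≡⟨ eval-balanced D (binary X) i ⟩
  eval D (binary X [ i ]≔ 2F)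
    ≡⟨ cong (eval D) (updateAt-cong-local i (binary X) moved) ⟨
  eval D (binary X [ i ]%= act₁ plus) ∎
  where
  update : ∀ b → D (X [ i ]≔ b) ≡ eval D (binary X [ i ]≔ digit b)
  update b = trans (sym (eval-binary D _)) (cong (eval D) (map-[]≔ digit X i))
  moved : act₁ plus (lookup (binary X) i) ≡ 2F
  moved rewrite lookup-map i digit X | eq = refl

-- Both sides are balanced in `w`, so `balanced-unique` leaves only binary words, where the left
-- side is the characteristic function.
eval-apply₁ : ∀ x (D : SetSystem n) i w →
              eval (apply₁ x D i) w ≡ eval D (w [ i ]%= act₁ x)
eval-apply₁ x D i = balanced-unique
  (eval-balanced _) (balanced-act₁ x i (eval D) (eval-balanced D))
  (λ X → trans (eval-binary _ X) (on-binary x X))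
  where
  on-binary : ∀ x X → apply₁ x D i X ≡ eval D (binary X [ i ]%= act₁ x)
  on-binary star X = begin
    (D ∗ i) X                            ≡⟨ ∗-feasible D i X ⟩
    D (X △ ⁅ i ⁆)                        ≡⟨ eval-binary D _ ⟨
    eval D (binary (X △ ⁅ i ⁆))          ≡⟨ cong (eval D) (binary-△ X i) ⟩
    eval D (binary X [ i ]%= act₁ star)  ∎
  on-binary plus = eval-+-binary D i

eval-permute : ∀ (π : Permutation′ n) (D : SetSystem n) w →
               eval (permute π D) w ≡ eval D (tabulate (lookup w ∘ (π ⟨$⟩ʳ_)))
eval-permute π D = balanced-unique
  (eval-balanced _) (balanced-permute π (eval D) (eval-balanced D)) λ X → begin
    eval (permute π D) (binary X)                         ≡⟨ eval-binary _ X ⟩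
    permute π D X                                         ≡⟨ permute-feasible π D X ⟩
    D (tabulate (lookup X ∘ (π ⟨$⟩ʳ_)))                   ≡⟨ eval-binary D _ ⟨
    eval D (binary (tabulate (lookup X ∘ (π ⟨$⟩ʳ_))))     ≡⟨ cong (eval D) (tabulate-∘ digit _) ⟨
    eval D (tabulate (digit ∘ lookup X ∘ (π ⟨$⟩ʳ_)))      ≡⟨ cong (eval D) (tabulate-cong λ i → lookup-map _ digit X) ⟨
    eval D (tabulate (lookup (binary X) ∘ (π ⟨$⟩ʳ_)))     ∎

-- Contravariant: the last letter of g acts first on set systems, hence last
-- on words.
act : 𝒢 → Fin 3 → Fin 3
act []      = id
act (x ∷ g) = act g ∘ act₁ x

eval-apply : ∀ (D : SetSystem n) g i w → eval (apply D g i) w ≡ eval D (w [ i ]%= act g)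
eval-apply D []      i w = cong (eval D) (sym (updateAt-id i w))
eval-apply D (x ∷ g) i w = begin
  eval (apply₁ x (apply D g i) i) w             ≡⟨ eval-apply₁ x (apply D g i) i w ⟩
  eval (apply D g i) (w [ i ]%= act₁ x)         ≡⟨ eval-apply D g i (w [ i ]%= act₁ x) ⟩
  eval D ((w [ i ]%= act₁ x) [ i ]%= act g)     ≡⟨ cong (eval D) (updateAt-updateAt i {f = act g} w) ⟩
  eval D (w [ i ]%= act (x ∷ g))                ∎

-- Serves the induction on `allFin`: the tail of `allFin (suc n)` consists of shifted positions,
-- whose updates never touch the head.
foldl-map-suc : ∀ (f : Fin (suc n) → A → A) is x (xs : Vec A n) →
  foldl (λ v i → v [ i ]%= f i) (x ∷ xs) (List.map suc is) ≡
  x ∷ foldl (λ v i → v [ i ]%= f (suc i)) xs is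
foldl-map-suc f []       x xs = refl
foldl-map-suc f (i ∷ is) x xs = foldl-map-suc f is x (xs [ i ]%= f (suc i))

foldl-allFin : ∀ (f : Fin n → A → A) (xs : Vec A n) →
  foldl (λ v i → v [ i ]%= f i) xs (allFin n) ≡ tabulate λ i → f i (lookup xs i)
foldl-allFin f []               = refl
foldl-allFin {suc n} f (x ∷ xs) = begin
  foldl step (f zero x ∷ xs) (List.tabulate suc)       ≡⟨ cong (foldl step _) (List.map-tabulate id suc) ⟨
  foldl step (f zero x ∷ xs) (List.map suc (allFin n)) ≡⟨ foldl-map-suc f (allFin n) _ xs ⟩
  f zero x ∷ foldl (λ v i → v [ i ]%= f (suc i)) xs (allFin n)
                                                       ≡⟨ cong (f zero x ∷_) (foldl-allFin (f ∘ suc) xs) ⟩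
  tabulate (λ i → f i (lookup (x ∷ xs) i))             ∎
  where step = λ v i → v [ i ]%= f i

-- The outermost operation on the set system is the first to change the word, so a right fold over
-- set systems turns into a left fold over words.
eval-· : ∀ (ĝ : Fin n → 𝒢) (D : SetSystem n) w →
         eval (ĝ · D) w ≡ eval D (tabulate λ i → act (ĝ i) (lookup w i))
eval-· {n} ĝ D w = trans (go (allFin n) w) (cong (eval D) (foldl-allFin (act ∘ ĝ) w))
  where
  go : ∀ is w → eval (foldr (λ i E → apply E (ĝ i) i) D is) w ≡
                eval D (foldl (λ v i → v [ i ]%= act (ĝ i)) w is)
  go []       w = refl
  go (i ∷ is) w = trans (eval-apply _ (ĝ i) i w) (go is _)

eval-▷ : ∀ ĝ π (D : SetSystem n) w →
         eval ((ĝ , π) ▷ D) w ≡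
         eval D (tabulate λ i → act (ĝ (π ⟨$⟩ʳ i)) (lookup w (π ⟨$⟩ʳ i)))
eval-▷ ĝ π D w = begin
  eval (ĝ · permute π D) w                   ≡⟨ eval-· ĝ (permute π D) w ⟩
  eval (permute π D) v                       ≡⟨ eval-permute π D v ⟩
  eval D (tabulate (lookup v ∘ (π ⟨$⟩ʳ_)))   ≡⟨ cong (eval D) (tabulate-cong λ i → lookup∘tabulate _ (π ⟨$⟩ʳ i)) ⟩
  _                                          ∎
  where v = tabulate λ i → act (ĝ i) (lookup w i)

-- Words of generators realise all permutations of the letters.

unact : 𝒢 → Fin 3 → Fin 3
unact []      = id
unact (x ∷ g) = act₁ x ∘ unact g

act₁-involutive : ∀ x t → act₁ x (act₁ x t) ≡ t
act₁-involutive star 0F = refl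
act₁-involutive star 1F = refl
act₁-involutive star 2F = refl
act₁-involutive plus 0F = refl
act₁-involutive plus 1F = refl
act₁-involutive plus 2F = refl

act-unact : ∀ g t → act g (unact g t) ≡ t
act-unact []      t = refl
act-unact (x ∷ g) t = trans (cong (act g) (act₁-involutive x _)) (act-unact g t)

unact-act : ∀ g t → unact g (act g t) ≡ t
unact-act []      t = refl
unact-act (x ∷ g) t = trans (cong (act₁ x) (unact-act g _)) (act₁-involutive x t)

act-injective : ∀ g {s t} → act g s ≡ act g t → s ≡ t
act-injective g {s} {t} eq = trans (sym (unact-act g s)) (trans (cong (unact g) eq) (unact-act g t))

-- This is the surjectivity of 𝒢 onto S₃: six reduced words give the six permutations, and an
-- injective `q` is one of them.
act-surjective : (q : Fin 3 → Fin 3) → (∀ {s t} → q s ≡ q t → s ≡ t) → ∃[ g ] act g ≗ q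
act-surjective q q-injective =
  let (g , eq₀ , eq₁ , eq₂) = Any.satisfied (table (q 0F) (q 1F) (q 2F)
        (λ eq → contradiction (q-injective eq) λ ())
        (λ eq → contradiction (q-injective eq) λ ())
        (λ eq → contradiction (q-injective eq) λ ()))
  in g , λ { 0F → eq₀ ; 1F → eq₁ ; 2F → eq₂ }
  where
  reducedWords : List 𝒢
  reducedWords = [] ∷ (star ∷ []) ∷ (plus ∷ []) ∷
                 (star ∷ plus ∷ []) ∷ (plus ∷ star ∷ []) ∷ star̄ ∷ []

  -- The decision procedure runs through all triples of distinct letters and searches `reducedWords`
  -- for each.
  table = toWitness {a? =
    all? λ a → all? λ b → all? λ c →
      ¬? (a ≟ᶠ b) →-dec ¬? (a ≟ᶠ c) →-dec ¬? (b ≟ᶠ c) →-dec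
      Any.any? (λ g → act g 0F ≟ᶠ a ×-dec act g 1F ≟ᶠ b ×-dec act g 2F ≟ᶠ c) reducedWords} _

-- Transversals as sections of a projection.

∣p∣≡0⇒p≡⊥ : (p : Subset n) → ∣ p ∣ ≡ 0 → p ≡ ⊥
∣p∣≡0⇒p≡⊥ []            eq = refl
∣p∣≡0⇒p≡⊥ (outside ∷ p) eq = cong (outside ∷_) (∣p∣≡0⇒p≡⊥ p eq)

∣p∣≡1⇒p≡⁅x⁆ : (p : Subset n) → ∣ p ∣ ≡ 1 → ∃[ x ] p ≡ ⁅ x ⁆
∣p∣≡1⇒p≡⁅x⁆ (inside  ∷ p) eq =
  zero , cong (inside ∷_) (∣p∣≡0⇒p≡⊥ p (ℕ.suc-injective eq))
∣p∣≡1⇒p≡⁅x⁆ (outside ∷ p) eq =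
  let (x , p≡) = ∣p∣≡1⇒p≡⁅x⁆ p eq in suc x , cong (outside ∷_) p≡

∣p∣≡1+k⇒nonempty : (p : Subset n) {k : ℕ} → ∣ p ∣ ≡ suc k → Nonempty p
∣p∣≡1+k⇒nonempty (inside  ∷ p) eq = zero , here
∣p∣≡1+k⇒nonempty (outside ∷ p) eq =
  let (x , x∈p) = ∣p∣≡1+k⇒nonempty p eq in suc x , there x∈p

module Sections {C : Carrier n} (p : Projection C) where
  open Carrier C
  open Projection p

  module _ (B : Subset size) (B-transversal : IsTransversal B) (i : Fin n) where
    private
      x = proj₁ (surjective i)
      k = proj₁ (partition x)

      σx≡i : σ x ≡ i
      σx≡i = proj₂ (surjective i) refl

      x∈k : x ∈ class k
      x∈k = proj₁ (proj₂ (partition x))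

      singleton : ∃[ y ] B ∩ class k ≡ ⁅ y ⁆
      singleton = ∣p∣≡1⇒p≡⁅x⁆ (B ∩ class k) (B-transversal k)

      ∈-both : proj₁ singleton ∈ B × proj₁ singleton ∈ class k
      ∈-both = x∈p∩q⁻ B (class k) (subst (proj₁ singleton ∈_) (sym (proj₂ singleton)) (x∈⁅x⁆ _))

    -- The point of `B` over `i`: the fibre over `i` is the skew class of any preimage `x`, and `B`
    -- meets that class once.
    pick : Fin size
    pick = proj₁ singleton

    pick-∈ : pick ∈ B
    pick-∈ = proj₁ ∈-both

    σ-pick : σ pick ≡ i
    σ-pick = trans (from (fibres pick x) (k , proj₂ ∈-both , x∈k)) σx≡i

    -- A point `z` over `i` shares a class with `x`; since `x` lies in only one class, `z` is in
    -- `B ∩ class k`, a singleton.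
    pick-unique : ∀ {z} → z ∈ B → σ z ≡ i → pick ≡ z
    pick-unique {z} z∈B σz≡i with to (fibres z x) (trans σz≡i (sym σx≡i))
    ... | k′ , z∈k′ , x∈k′ = sym (x∈⁅y⁆⇒x≡y _ (subst (z ∈_) (proj₂ singleton)
            (x∈p∩q⁺ (z∈B , subst (λ k → z ∈ class k) (sym (proj₂ (proj₂ (partition x)) x∈k′)) z∈k′))))

  -- When `f` is a right inverse of `σ` this is the image of `f`, expressed as a fixed-point
  -- condition so that membership needs no search for a preimage.
  section : (Fin n → Fin size) → Subset size
  section f = tabulate λ x → does (f (σ x) ≟ᶠ x)

  ∈-section : ∀ f {x} → x ∈ section f ⇔ f (σ x) ≡ x
  ∈-section f = ∈-tabulate λ x → f (σ x) ≟ᶠ x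

  -- `class-size` supplies a point `c` of the class. As `σ` is constant on the class, `f (σ c)` is
  -- the only point of the section in it.
  section-transversal : ∀ f → (∀ i → σ (f i) ≡ i) → IsTransversal (section f)
  section-transversal f σf k =
    let (c , c∈k) = ∣p∣≡1+k⇒nonempty (class k) (class-size k)
        (k′ , fσc∈k′ , c∈k′) = to (fibres (f (σ c)) c) (σf (σ c))
        k′≡k = trans (sym (proj₂ (proj₂ (partition c)) c∈k′)) (proj₂ (proj₂ (partition c)) c∈k)
        fσc∈k = subst (λ k → f (σ c) ∈ class k) k′≡k fσc∈k′
    in trans (cong ∣_∣ (subset-ext λ {x} → mk⇔
      (λ x∈ → let (x∈s , x∈k) = x∈p∩q⁻ _ _ x∈ in
        from x∈⁅y⁆⇔x≡y (trans (sym (to (∈-section f) x∈s))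
          (cong f (from (fibres x c) (k , x∈k , c∈k)))))
      (λ x∈ → subst (_∈ section f ∩ class k) (sym (x∈⁅y⁆⇒x≡y _ x∈))
        (x∈p∩q⁺ (from (∈-section f) (cong f (σf (σ c))) , fσc∈k)))))
      (∣⁅x⁆∣≡1 (f (σ c)))

-- Bases of the lift.

module _ {C : Carrier n} where
  open Carrier C

  sameFibre : (p q : Projection C) → ∀ {x y} →
              Projection.σ p x ≡ Projection.σ p y → Projection.σ q x ≡ Projection.σ q y
  sameFibre p q {x} {y} = from (Projection.fibres q x y) ∘ to (Projection.fibres p x y)

  -- Both transversals have exactly one point over each position, and inclusion forces these points
  -- to agree. Hence the members of `𝓑` form an antichain.
  transversal-⊆ : Projection C → ∀ {B B′} → IsTransversal B → IsTransversal B′ →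
                  B ⊆ B′ → B′ ⊆ B
  transversal-⊆ p {B} {B′} tB tB′ B⊆B′ {x} x∈B′ = subst (_∈ B)
    (trans (sym (pick-unique B′ tB′ (σ x) (B⊆B′ (pick-∈ B tB (σ x))) (σ-pick B tB (σ x))))
           (pick-unique B′ tB′ (σ x) x∈B′ refl))
    (pick-∈ B tB (σ x))
    where
    open Sections p
    open Projection p

  𝓑⇒transversal : ∀ D τ (p : Projection C) {B} → B ∈ᶠ 𝓑 D τ p → IsTransversal B
  𝓑⇒transversal D τ p {B} = proj₁ ∘ to (does⇔ (isTransversal? B ×-dec
    σ [ B ∩ T₂ ] ∈ᶠ? (D ∗̄ (σ [ B ∩ T₃ ]))))
    where
    open TransversalTuple τ
    open Projection p

  -- A maximal independent set equals the member of `𝓑` containing it. Conversely, a strictly larger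
  -- independent set would put one transversal properly inside another.
  basis⇔𝓑 : ∀ D τ (p : Projection C) {B} →
            IndependenceSystem.IsBasis (liftZ D τ p) B ⇔ B ∈ᶠ 𝓑 D τ p
  basis⇔𝓑 D τ p {B} = mk⇔
    (λ (B-ind , maximal) →
      let (B′ , B′∈𝓑 , B⊆B′) = to (independent⇔ B) B-ind
          B′⊆B : B′ ⊆ B
          -- Maximality only refutes a point of `B′` outside `B`; decidable membership turns this
          -- into inclusion.
          B′⊆B {x} x∈B′ = decidable-stable (x ∈? B) λ x∉B →
            maximal (B′ , from (independent⇔ B′) (B′ , B′∈𝓑 , ⊆-refl) , B⊆B′ , x , x∈B′ , x∉B)
      in subst (_∈ᶠ 𝓑 D τ p) (⊆-antisym B′⊆B B⊆B′) B′∈𝓑)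
    (λ B∈𝓑 → from (independent⇔ B) (B , B∈𝓑 , ⊆-refl) ,
      λ (I , I-ind , B⊆I , x , x∈I , x∉B) →
        let (B′ , B′∈𝓑 , I⊆B′) = to (independent⇔ I) I-ind
        in x∉B (transversal-⊆ p (𝓑⇒transversal D τ p B∈𝓑) (𝓑⇒transversal D τ p B′∈𝓑)
                  (⊆-trans B⊆I I⊆B′) (I⊆B′ x∈I)))
    where
    independent⇔ : ∀ I → I ∈ᶠ IndependenceSystem.independent (liftZ D τ p) ⇔
                         (∃[ B ] B ∈ᶠ 𝓑 D τ p × I ⊆ B)
    independent⇔ I = does⇔ (anySubset? λ B → B ∈ᶠ? 𝓑 D τ p ×-dec I ⊆? B)

-- Coordinates on `U`, and transversals as words.

module Coordinates {C : Carrier n} (τ : TransversalTuple C) (p : Projection C) where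
  open Carrier C
  open TransversalTuple τ
  open Projection p
  open Sections p

  -- The numbering matches the functionals: `T₁` is outside, `T₂` is inside, and `T₃`, where `∗̄` is
  -- applied, is their sum.
  side : Fin 3 → Subset size
  side 0F = T₁
  side 1F = T₂
  side 2F = T₃

  side-transversal : ∀ t → IsTransversal (side t)
  side-transversal 0F = T₁-transversal
  side-transversal 1F = T₂-transversal
  side-transversal 2F = T₃-transversal

  -- Inverse of the coordinate map sending `x` to `σ x` and `label x`.
  point : Fin n → Fin 3 → Fin size
  point i t = pick (side t) (side-transversal t) i

  σ-point : ∀ i t → σ (point i t) ≡ i
  σ-point i t = σ-pick (side t) (side-transversal t) i

  side-unique : ∀ {x} s t → x ∈ side s → x ∈ side t → s ≡ t
  side-unique 0F 0F _ _ = refl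
  side-unique 0F 1F a b = contradiction (_ , x∈p∩q⁺ (a , b)) T₁-T₂-disjoint
  side-unique 0F 2F a b = contradiction (_ , x∈p∩q⁺ (a , b)) T₁-T₃-disjoint
  side-unique 1F 0F a b = contradiction (_ , x∈p∩q⁺ (b , a)) T₁-T₂-disjoint
  side-unique 1F 1F _ _ = refl
  side-unique 1F 2F a b = contradiction (_ , x∈p∩q⁺ (a , b)) T₂-T₃-disjoint
  side-unique 2F 0F a b = contradiction (_ , x∈p∩q⁺ (b , a)) T₁-T₃-disjoint
  side-unique 2F 1F a b = contradiction (_ , x∈p∩q⁺ (b , a)) T₂-T₃-disjoint
  side-unique 2F 2F _ _ = refl

  private
    labelled : ∀ x → ∃[ t ] x ∈ side t
    labelled x with x∈p∪q⁻ T₁ (T₂ ∪ T₃) (subst (x ∈_) (sym union) ∈⊤)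
    ... | inj₁ x∈T₁ = 0F , x∈T₁
    ... | inj₂ x∈T₂∪T₃ with x∈p∪q⁻ T₂ T₃ x∈T₂∪T₃
    ...   | inj₁ x∈T₂ = 1F , x∈T₂
    ...   | inj₂ x∈T₃ = 2F , x∈T₃

  label : Fin size → Fin 3
  label = proj₁ ∘ labelled

  ∈-side : ∀ {x t} → x ∈ side t ⇔ label x ≡ t
  ∈-side {x} {t} = mk⇔
    (side-unique (label x) t (proj₂ (labelled x)))
    λ { refl → proj₂ (labelled x) }

  label-point : ∀ i t → label (point i t) ≡ t
  label-point i t = to ∈-side (pick-∈ (side t) (side-transversal t) i)

  point-unique : ∀ {x i t} → σ x ≡ i → label x ≡ t → point i t ≡ x
  point-unique {t = t} σx≡i lx≡t = pick-unique (side t) (side-transversal t) _ (from ∈-side lx≡t) σx≡i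

  coordinates-injective : ∀ {x y} → σ x ≡ σ y → label x ≡ label y → x ≡ y
  coordinates-injective σ≡ l≡ = trans (sym (point-unique σ≡ l≡)) (point-unique refl refl)

  transversal : Word n → Subset size
  transversal w = section λ i → point i (lookup w i)

  transversal-isTransversal : ∀ w → IsTransversal (transversal w)
  transversal-isTransversal w = section-transversal _ λ i → σ-point i (lookup w i)

  ∈-transversal⇔point : ∀ w {x} → x ∈ transversal w ⇔ point (σ x) (lookup w (σ x)) ≡ x
  ∈-transversal⇔point w = ∈-section λ i → point i (lookup w i)

  ∈-transversal : ∀ w {x} → x ∈ transversal w ⇔ lookup w (σ x) ≡ label x
  ∈-transversal w {x} = mk⇔
    (λ x∈ → trans (sym (label-point (σ x) _)) (cong label (to (∈-transversal⇔point w) x∈)))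
    (λ eq → from (∈-transversal⇔point w) (point-unique refl (sym eq)))

  point∈transversal : ∀ w i → point i (lookup w i) ∈ transversal w
  point∈transversal w i = from (∈-transversal⇔point w)
    (cong (λ j → point j (lookup w j)) (σ-point i (lookup w i)))

  transversal-surjective : ∀ {B} → IsTransversal B → ∃[ w ] B ≡ transversal w
  transversal-surjective {B} B-transversal = w , subset-ext λ {x} → mk⇔
    (λ x∈B → from (∈-transversal w) (trans (lookup∘tabulate _ (σ x))
      (cong label (pick-unique B B-transversal (σ x) x∈B refl))))
    (λ x∈ → subst (_∈ B)
      (coordinates-injective (σ-pick B B-transversal (σ x))
        (trans (sym (lookup∘tabulate _ (σ x))) (to (∈-transversal w) x∈)))
      (pick-∈ B B-transversal (σ x)))
    where w = tabulate λ i → label (pick B B-transversal i)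

  ∈-σ[transversal∩side] : ∀ w t {i} → i ∈ σ [ transversal w ∩ side t ] ⇔ lookup w i ≡ t
  ∈-σ[transversal∩side] w t {i} = mk⇔
    (λ i∈ → let (x , x∈ , σx≡i) = to (∈-image σ _) i∈
                (x∈w , x∈t) = x∈p∩q⁻ _ _ x∈
            in trans (cong (lookup w) (sym σx≡i)) (trans (to (∈-transversal w) x∈w) (to ∈-side x∈t)))
    (λ { refl → from (∈-image σ _)
      (point i t , x∈p∩q⁺ (point∈transversal w i , from ∈-side (label-point i t)) , σ-point i t) })

  σ[transversal-binary∩T₂] : ∀ Y → σ [ transversal (binary Y) ∩ T₂ ] ≡ Y
  σ[transversal-binary∩T₂] Y = subset-ext λ {i} → mk⇔
    (λ i∈ → lookup⇒[]= i Y (digit≡1F _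
      (trans (sym (lookup-map i digit Y)) (to (∈-σ[transversal∩side] (binary Y) 1F) i∈))))
    (λ i∈Y → from (∈-σ[transversal∩side] (binary Y) 1F)
      (trans (lookup-map i digit Y) (cong digit ([]=⇒lookup i∈Y))))
    where
    digit≡1F : ∀ b → digit b ≡ 1F → b ≡ true
    digit≡1F true _ = refl

  transversal-binary⊆T₁∪T₂ : ∀ Y → transversal (binary Y) ⊆ T₁ ∪ T₂
  transversal-binary⊆T₁∪T₂ Y {x} x∈ = x∈p∪q⁺ (go (lookup Y (σ x))
    (trans (sym (to (∈-transversal (binary Y)) x∈)) (lookup-map (σ x) digit Y)))
    where
    go : ∀ b → label x ≡ digit b → x ∈ T₁ ⊎ x ∈ T₂
    go false eq = inj₁ (from ∈-side eq)
    go true  eq = inj₂ (from ∈-side eq)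

  lookup-σ[transversal∩side] : ∀ w t i →
    lookup (σ [ transversal w ∩ side t ]) i ≡ does (lookup w i ≟ᶠ t)
  lookup-σ[transversal∩side] w t i = T⇔⇒≡does
    (mk⇔ (to (∈-σ[transversal∩side] w t) ∘ T⇒∈) (∈⇒T ∘ from (∈-σ[transversal∩side] w t)))
    (lookup w i ≟ᶠ t)
    where
    X = σ [ transversal w ∩ side t ]

    T⇒∈ : T (lookup X i) → i ∈ X
    T⇒∈ = lookup⇒[]= i X ∘ to T-≡

    ∈⇒T : i ∈ X → T (lookup X i)
    ∈⇒T = from T-≡ ∘ []=⇒lookup

  transversal⊆T₁∪T₂⇒binary : ∀ w → transversal w ⊆ T₁ ∪ T₂ →
                             w ≡ binary (σ [ transversal w ∩ T₂ ])
  transversal⊆T₁∪T₂⇒binary w ⊆T₁∪T₂ = lookup-ext w _ λ i → begin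
    lookup w i                                    ≡⟨ digits i ⟩
    digit (does (lookup w i ≟ᶠ 1F))               ≡⟨ cong digit (lookup-σ[transversal∩side] w 1F i) ⟨
    digit (lookup (σ [ transversal w ∩ T₂ ]) i)   ≡⟨ lookup-map i digit (σ [ transversal w ∩ T₂ ]) ⟨
    lookup (binary (σ [ transversal w ∩ T₂ ])) i  ∎
    where
    digits : ∀ i → lookup w i ≡ digit (does (lookup w i ≟ᶠ 1F))
    digits i with lookup w i in eq
    ... | 0F = refl
    ... | 1F = refl
    -- A letter `2F` would place a point of `T₃` in `T₁ ∪ T₂`.
    ... | 2F with x∈p∪q⁻ T₁ T₂ (⊆T₁∪T₂ (subst (λ t → point i t ∈ transversal w) eq (point∈transversal w i)))
    ...   | inj₁ ∈T₁ = contradiction (trans (sym (label-point i 2F)) (to (∈-side {t = 0F}) ∈T₁)) λ ()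
    ...   | inj₂ ∈T₂ = contradiction (trans (sym (label-point i 2F)) (to (∈-side {t = 1F}) ∈T₂)) λ ()

  -- Positions lettered `2F` lie outside `X`, so they read `0F` in `binary X`, and `star̄` carries
  -- `0F` to `2F`; the other positions are left alone. So membership in `𝓑` is the value of the
  -- word.
  ∗̄-feasible : ∀ D w → (D ∗̄ (σ [ transversal w ∩ T₃ ])) (σ [ transversal w ∩ T₂ ]) ≡ eval D w
  ∗̄-feasible D w = begin
    (D ∗̄ I) X                        ≡⟨ eval-binary (D ∗̄ I) X ⟨
    eval (D ∗̄ I) (binary X)          ≡⟨ eval-· ĝ D (binary X) ⟩
    eval D (tabulate λ i → act (ĝ i) (lookup (binary X) i))
      ≡⟨ cong (eval D) (trans (tabulate-cong letter) (tabulate∘lookup w)) ⟩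
    eval D w                         ∎
    where
    X = σ [ transversal w ∩ T₂ ]
    I = σ [ transversal w ∩ T₃ ]

    ĝ : Fin n → 𝒢
    ĝ i = if does (i ∈? I) then star̄ else []

    letter : ∀ i → act (ĝ i) (lookup (binary X) i) ≡ lookup w i
    -- The rewrites express both `binary X` and `ĝ` at `i` through the letter of `w`, after which
    -- each case computes.
    letter i rewrite lookup-map i digit X
                   | lookup-σ[transversal∩side] w 1F i
                   | does-⇔ (∈-σ[transversal∩side] w 2F) (i ∈? I) (lookup w i ≟ᶠ 2F)
      with lookup w i
    ... | 0F = refl
    ... | 1F = refl
    ... | 2F = refl

  transversal∈𝓑 : ∀ D w → transversal w ∈ᶠ 𝓑 D τ p ⇔ T (eval D w)
  transversal∈𝓑 D w = mk⇔
    (λ ∈𝓑 → subst T (∗̄-feasible D w) (proj₂ (to 𝓑⇔ ∈𝓑)))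
    (λ ev → from 𝓑⇔ (transversal-isTransversal w , subst T (sym (∗̄-feasible D w)) ev))
    where
    𝓑⇔ = does⇔ (isTransversal? (transversal w) ×-dec
                σ [ transversal w ∩ T₂ ] ∈ᶠ? (D ∗̄ (σ [ transversal w ∩ T₃ ])))

  -- A transversal inside `T₁ ∪ T₂` has a word free of `2F`, that is, a binary word, and its trace
  -- on `T₂` recovers the subset.
  project-feasible : ∀ (Z : IndependenceSystem C) →
    (∀ {B} → IndependenceSystem.IsBasis Z B → IsTransversal B) → ∀ Y →
    T (project Z τ p Y) ⇔ IndependenceSystem.IsBasis Z (transversal (binary Y))
  project-feasible Z basis⇒transversal Y = mk⇔
    (λ Y∈ → let (X , (X-basis , X⊆) , Y≡) = to project⇔ Y∈
                (w , X≡) = transversal-surjective (basis⇒transversal X-basis)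
                w≡ = transversal⊆T₁∪T₂⇒binary w (subst (_⊆ T₁ ∪ T₂) X≡ X⊆)
                Y≡′ = trans Y≡ (cong (λ X → σ [ X ∩ T₂ ]) X≡)
            in subst IsBasis (trans X≡ (cong transversal (trans w≡ (cong binary (sym Y≡′))))) X-basis)
    (λ basis → from project⇔ (transversal (binary Y) ,
      (basis , transversal-binary⊆T₁∪T₂ Y) , sym (σ[transversal-binary∩T₂] Y)))
    where
    open IndependenceSystem Z
    project⇔ = does⇔ (anySubset? λ X → (isBasis? X ×-dec X ⊆? (T₁ ∪ T₂)) ×-dec Y ≟ˢ (σ [ X ∩ T₂ ]))

-- Change of coordinates between two pairs.

module _ {C : Carrier n} (τ : TransversalTuple C) (p : Projection C)
         (τ′ : TransversalTuple C) (p′ : Projection C) where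
  open Carrier C
  private
    module K  = Coordinates τ p
    module K′ = Coordinates τ′ p′
    open Projection p
    open Projection p′ renaming (σ to σ′) hiding (surjective; fibres)

  -- The map through which `σ′` factors over `σ`. The letter `0F` merely chooses a point over `i`;
  -- `relabel-σ` shows that any other gives the same value.
  relabel : Fin n → Fin n
  relabel i = σ′ (K.point i 0F)

  relabel-σ : ∀ x → relabel (σ x) ≡ σ′ x
  relabel-σ x = sameFibre p p′ (K.σ-point (σ x) 0F)

  translate : Word n → Word n
  translate w = tabulate λ i → K.label (K′.point (relabel i) (lookup w (relabel i)))

  -- Both sides compare `x` with the point that the primed word selects in its skew class: the left
  -- as points of `U`, the right by unprimed labels, which separate points of one class.
  transversal-translate : ∀ w → K′.transversal w ≡ K.transversal (translate w)
  transversal-translate w = subset-ext λ {x} → mk⇔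
    (λ x∈ → from (K.∈-transversal (translate w)) (trans (lookup-translate x)
      (cong K.label (to (K′.∈-transversal⇔point w) x∈))))
    (λ x∈ → from (K′.∈-transversal⇔point w) (K.coordinates-injective
      (sameFibre p′ p (K′.σ-point (σ′ x) (lookup w (σ′ x))))
      (trans (sym (lookup-translate x)) (to (K.∈-transversal (translate w)) x∈))))
    where
    lookup-translate : ∀ x → lookup (translate w) (σ x) ≡ K.label (K′.point (σ′ x) (lookup w (σ′ x)))
    lookup-translate x = trans (lookup∘tabulate _ (σ x))
      (cong (λ j → K.label (K′.point j (lookup w j))) (relabel-σ x))

  project-liftZ : ∀ D Y → project (liftZ D τ p) τ′ p′ Y ≡ eval D (translate (binary Y))
  project-liftZ D Y = T⇔T⇒≡ (mk⇔
    (λ Y∈ → to (K.transversal∈𝓑 D v) (subst (_∈ᶠ 𝓑 D τ p) (transversal-translate (binary Y))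
              (to (basis⇔𝓑 D τ p) (to project⇔ Y∈))))
    (λ ev → from project⇔ (from (basis⇔𝓑 D τ p)
              (subst (_∈ᶠ 𝓑 D τ p) (sym (transversal-translate (binary Y)))
                (from (K.transversal∈𝓑 D v) ev)))))
    where
    v = translate (binary Y)
    project⇔ = K′.project-feasible (liftZ D τ p)
      (λ B-basis → 𝓑⇒transversal D τ p (to (basis⇔𝓑 D τ p) B-basis)) Y

  -- Common core of both inclusions: one reads `π` and `ĝ` off two given pairs, the other builds a
  -- pair with prescribed `π` and `ĝ`.
  project-liftZ≗▷ : ∀ D ĝ (π : Permutation′ n) →
    (∀ i → relabel i ≡ π ⟨$⟩ʳ i) → (∀ j t → K.label (K′.point j t) ≡ act (ĝ j) t) →
    project (liftZ D τ p) τ′ p′ ≗ (ĝ , π) ▷ D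
  project-liftZ≗▷ D ĝ π relabel≡π label≡act Y = begin
    project (liftZ D τ p) τ′ p′ Y        ≡⟨ project-liftZ D Y ⟩
    eval D (translate (binary Y))      ≡⟨ cong (eval D) (tabulate-cong λ i →
      trans (cong (λ j → K.label (K′.point j (lookup (binary Y) j))) (relabel≡π i))
            (label≡act (π ⟨$⟩ʳ i) _)) ⟩
    eval D (tabulate λ i → act (ĝ (π ⟨$⟩ʳ i)) (lookup (binary Y) (π ⟨$⟩ʳ i)))
                                         ≡⟨ eval-▷ ĝ π D (binary Y) ⟨
    eval ((ĝ , π) ▷ D) (binary Y)        ≡⟨ eval-binary _ Y ⟩
    ((ĝ , π) ▷ D) Y                      ∎

-- The two inclusions.

module _ {C : Carrier n} (τ : TransversalTuple C) (p : Projection C) where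
  open Carrier C
  open Projection p
  open Coordinates τ p

  module _ (τ′ : TransversalTuple C) (p′ : Projection C) where
    private
      module K′ = Coordinates τ′ p′

    relabelling : Permutation′ n
    -- The inverse exchanges the roles of the two pairs; each round trip is `relabel-σ` at a point
    -- over the given position.
    relabelling = permutation (relabel τ p τ′ p′) (relabel τ′ p′ τ p)
      (λ j → trans (relabel-σ τ p τ′ p′ (K′.point j 0F)) (K′.σ-point j 0F))
      (λ i → trans (relabel-σ τ′ p′ τ p (point i 0F)) (σ-point i 0F))

    -- The three points over `j` fill one skew class, on which labels are injective, so
    -- `act-surjective` applies.
    sidePermutation : ∀ j → ∃[ g ] act g ≗ label ∘ K′.point j
    sidePermutation j = act-surjective (label ∘ K′.point j) λ {s} {t} eq → begin
      s                       ≡⟨ K′.label-point j s ⟨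
      K′.label (K′.point j s) ≡⟨ cong K′.label (coordinates-injective (sameFibre p′ p
                                   (trans (K′.σ-point j s) (sym (K′.σ-point j t)))) eq) ⟩
      K′.label (K′.point j t) ≡⟨ K′.label-point j t ⟩
      t                       ∎

    project-liftZ∈Orb : ∀ D {E} → E ≗ project (liftZ D τ p) τ′ p′ → Orb D E
    project-liftZ∈Orb D E≗ = (proj₁ ∘ sidePermutation , relabelling) , λ X → trans (E≗ X)
      (project-liftZ≗▷ τ p τ′ p′ D (proj₁ ∘ sidePermutation) relabelling
        (λ _ → refl) (λ j t → sym (proj₂ (sidePermutation j) t)) X)

  module _ (ĝ : Fin n → 𝒢) (π : Permutation′ n) where

    movedProjection : Projection C
    movedProjection = record
      { σ          = (π ⟨$⟩ʳ_) ∘ σ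
      ; surjective = λ j → let (x , σx) = surjective (π ⟨$⟩ˡ j) in
          x , λ { refl → trans (cong (π ⟨$⟩ʳ_) (σx refl)) (inverseʳ π) }
      ; fibres     = λ x y → mk⇔
          (λ eq → to (fibres x y) (trans (sym (inverseˡ π)) (trans (cong (π ⟨$⟩ˡ_) eq) (inverseˡ π))))
          (λ same → cong (π ⟨$⟩ʳ_) (from (fibres x y) same))
      }

    private
      open Sections movedProjection using (section; section-transversal; ∈-section)

      -- Chosen so that the new point over `j` with letter `t` has old label `act (ĝ j) t`, as
      -- `project-liftZ≗▷` demands.
      movedPoint : Fin 3 → Fin n → Fin size
      movedPoint t j = point (π ⟨$⟩ˡ j) (act (ĝ j) t)

      σ-movedPoint : ∀ t j → π ⟨$⟩ʳ σ (movedPoint t j) ≡ j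
      σ-movedPoint t j = trans (cong (π ⟨$⟩ʳ_) (σ-point (π ⟨$⟩ˡ j) (act (ĝ j) t))) (inverseʳ π)

      movedSide : Fin 3 → Subset size
      movedSide t = section (movedPoint t)

      ∈-movedSide : ∀ t {x} → x ∈ movedSide t ⇔ act (ĝ (π ⟨$⟩ʳ σ x)) t ≡ label x
      ∈-movedSide t {x} = mk⇔
        (λ x∈ → trans (sym (label-point _ _)) (cong label (to (∈-section (movedPoint t)) x∈)))
        (λ eq → from (∈-section (movedPoint t)) (point-unique (sym (inverseˡ π)) (sym eq)))

      movedSide-disjoint : ∀ s t → s ≢ t → Empty (movedSide s ∩ movedSide t)
      movedSide-disjoint s t s≢t (x , x∈) =
        let (x∈s , x∈t) = x∈p∩q⁻ _ _ x∈
        in s≢t (act-injective (ĝ (π ⟨$⟩ʳ σ x))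
             (trans (to (∈-movedSide s) x∈s) (sym (to (∈-movedSide t) x∈t))))

      movedSide-union : ∀ x → x ∈ movedSide 0F ∪ movedSide 1F ∪ movedSide 2F
      -- The side containing `x` is found by undoing the letter change on its old label.
      movedSide-union x = go (unact g (label x)) (from (∈-movedSide _) (act-unact g (label x)))
        where
        g = ĝ (π ⟨$⟩ʳ σ x)

        go : ∀ t → x ∈ movedSide t → x ∈ movedSide 0F ∪ movedSide 1F ∪ movedSide 2F
        go 0F x∈ = x∈p∪q⁺ (inj₁ x∈)
        go 1F x∈ = x∈p∪q⁺ (inj₂ (x∈p∪q⁺ (inj₁ x∈)))
        go 2F x∈ = x∈p∪q⁺ (inj₂ (x∈p∪q⁺ (inj₂ x∈)))

    movedTuple : TransversalTuple C
    movedTuple = record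
      { T₁ = movedSide 0F
      ; T₂ = movedSide 1F
      ; T₃ = movedSide 2F
      ; T₁-transversal = section-transversal _ (σ-movedPoint 0F)
      ; T₂-transversal = section-transversal _ (σ-movedPoint 1F)
      ; T₃-transversal = section-transversal _ (σ-movedPoint 2F)
      ; T₁-T₂-disjoint = movedSide-disjoint 0F 1F λ ()
      ; T₁-T₃-disjoint = movedSide-disjoint 0F 2F λ ()
      ; T₂-T₃-disjoint = movedSide-disjoint 1F 2F λ ()
      ; union          = ⊆-antisym ⊆⊤ λ {x} _ → movedSide-union x
      }

    private
      module K′ = Coordinates movedTuple movedProjection

      -- Both sides agree definitionally only once the letter is known, because `side` is defined by
      -- cases.
      side-moved : ∀ t → K′.side t ≡ movedSide t
      side-moved 0F = refl
      side-moved 1F = refl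
      side-moved 2F = refl

    label-moved : ∀ j t → label (K′.point j t) ≡ act (ĝ j) t
    label-moved j t = begin
      label (K′.point j t)                           ≡⟨ to (∈-movedSide t) point∈ ⟨
      act (ĝ (π ⟨$⟩ʳ σ (K′.point j t))) t            ≡⟨ cong (λ k → act (ĝ k) t) (K′.σ-point j t) ⟩
      act (ĝ j) t                                    ∎
      where
      point∈ : K′.point j t ∈ movedSide t
      point∈ = subst (K′.point j t ∈_) (side-moved t) (from K′.∈-side (K′.label-point j t))

    ▷≗project-liftZ : ∀ D → (ĝ , π) ▷ D ≗ project (liftZ D τ p) movedTuple movedProjection
    ▷≗project-liftZ D X = sym (project-liftZ≗▷ τ p movedTuple movedProjection D ĝ π
      (λ i → cong (π ⟨$⟩ʳ_) (σ-point i 0F)) label-moved X)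

theorem5p7 : (n : ℕ) (D : SetSystem n) →
    IsDeltaMatroid D → VfSafe D →
    (C : Carrier n) (τ : TransversalTuple C) (σ : Projection C) →
    Orb D ≐ (λ E → ∃[ τ′ ] ∃[ σ′ ] E ≗ project {C = C} (liftZ D τ σ) τ′ σ′)
theorem5p7 n D _ _ C τ σ =
  (λ { ((ĝ , π) , E≗) → movedTuple τ σ ĝ π , movedProjection τ σ ĝ π ,
         λ X → trans (E≗ X) (▷≗project-liftZ τ σ ĝ π D X) }) ,
  (λ { (τ′ , σ′ , E≗) → project-liftZ∈Orb τ σ τ′ σ′ D E≗ })
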